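{- Let $m\ge 1$ and let $\mu$ be the 2-alternating assignment with $m$ blocks on the $1\times(2m+1)$ strip of stamps. Then the number of valid layer orderings for $\mu$ is $c(\mu)=C_{\lfloor m/2\rfloor+1}\,C_{\lceil m/2\rceil+1}$, where $C_k=\frac{1}{k+1}\binom{2k}{k}$ is the $k$-th Catalan number.
   Context: A $1\times n$ strip of stamps has faces labeled $0,1,\dots,n-1$ from left to right and $n-1$ creases, the crease $(i,i+1)$ lying between faces $i$ and $i+1$. A mountain-valley (MV) assignment is a map $\mu$ from the creases to $\{M,V\}$, written as the word $\mu((0,1))\mu((1,2))\cdots\mu((n-2,n-1))$; $S^k$ denotes the word $S$ repeated $k$ times. The 2-alternating assignment with $m$ blocks is $(M^2V^2)^{m/2}$ for even $m$ and $(M^2V^2)^{(m-1)/2}M^2$ for odd $m$ (a word of length $2m$, hence on a $1\times(2m+1)$ strip). A permutation $\sigma$ of $\{0,\dots,n-1\}$ ($\sigma(i)$ = position of face $i$ in the folded stack, left to right) is a valid layer ordering for $\mu$ if: (1) for each crease $(i,i+1)$, if $\mu((i,i+1))=M$ and $i$ is even, or $\mu((i,i+1))=V$ and $i$ is odd, then $\sigma(i)>\sigma(i+1)$; otherwise $\sigma(i)<\sigma(i+1)$; (2) for any two creases $(i,i+1),(j,j+1)$ with $i\equiv j\pmod 2$, it is not the case that $\sigma(i)<\sigma(j)<\sigma(i+1)<\sigma(j+1)$, nor that this chain holds for any cyclic rotation of the sequence $(\sigma(i),\sigma(j),\sigma(i+1),\sigma(j+1))$. $c(\mu)$ denotes the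 number of valid layer orderings for $\mu$. -}

module Defs where

open import Data.Nat using (ℕ; zero; suc; _+_; _*_; _<_; _/_; _%_)
open import Data.Nat.Combinatorics using (_C_)
open import Data.Bool using (Bool; true; false; if_then_else_)
open import Data.Fin using (Fin; toℕ; inject₁) renaming (suc to fsuc)
open import Data.Vec using (Vec; []; _∷_; lookup)
open import Data.List using (List; length)
open import Data.List.Relation.Unary.Unique.Propositional using (Unique)
open import Data.List.Membership.Propositional using (_∈_)
open import Data.Product using (Σ; _×_)
open import Data.Sum using (_⊎_)
open import Relation.Binary.PropositionalEquality using (_≡_)
open import Relation.Nullary using (¬_)
open import Function.Bundles using (_⇔_)

-- mountain / valley labels
data MV : Set where
  M V : MV

-- Catalan number C_k = (1/(k+1)) * binom(2k, k)  (exact division)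
catalan : ℕ → ℕ
catalan k = ((2 * k) C k) / suc k

-- The 2-alternating assignment with m blocks, as a word of length 2m
-- (written m * 2 so the recursion typechecks definitionally):
-- (M²V²)^{m/2} for even m, (M²V²)^{(m-1)/2} M² for odd m.
twoAlt : (m : ℕ) → Vec MV (m * 2)
twoAlt zero = []
twoAlt (suc zero) = M ∷ M ∷ []
twoAlt (suc (suc m)) = M ∷ M ∷ V ∷ V ∷ twoAlt m

even? : ℕ → Bool
even? zero = true
even? (suc zero) = false
even? (suc (suc n)) = even? n

-- true iff crease i with label x forces σ(i) > σ(i+1)
-- (μ = M and i even, or μ = V and i odd)
reversed : MV → ℕ → Bool
reversed M i = even? i
reversed V i = if even? i then false else true

-- A strip with k creases has k+1 faces 0..k. Crease c : Fin k lies between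
-- faces inject₁ c (= c) and fsuc c (= c+1).
-- A layer ordering σ is given as the vector (σ(0), …, σ(k)) of positions.
module _ {k : ℕ} (μ : Vec MV k) (σ : Vec (Fin (suc k)) (suc k)) where

  pos : Fin (suc k) → ℕ
  pos f = toℕ (lookup σ f)

  left right : Fin k → ℕ
  left c = pos (inject₁ c)
  right c = pos (fsuc c)

  -- σ is a permutation of the faces (injective self-map of a finite set)
  IsPerm : Set
  IsPerm = ∀ f g → lookup σ f ≡ lookup σ g → f ≡ g

  CreaseOK : Set
  CreaseOK = ∀ c → if reversed (lookup μ c) (toℕ c)
                     then right c < left c
                     else left c < right c

  Chain : ℕ → ℕ → ℕ → ℕ → Set
  Chain a b c d = a < b × b < c × c < d

  Crossing : ℕ → ℕ → ℕ → ℕ → Set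
  Crossing a b c d = Chain a b c d ⊎ Chain b c d a ⊎ Chain c d a b ⊎ Chain d a b c

  NoCrossing : Set
  NoCrossing = ∀ c d → even? (toℕ c) ≡ even? (toℕ d) →
               ¬ Crossing (left c) (left d) (right c) (right d)

  ValidLayerOrdering : Set
  ValidLayerOrdering = IsPerm × CreaseOK × NoCrossing

HasCount : {A : Set} → (A → Set) → ℕ → Set
HasCount {A} P n = Σ (List A) λ xs → Unique xs × length xs ≡ n × (∀ a → (a ∈ xs) ⇔ P a)

{-# OPTIONS --safe #-}

-- Call the creases of even (odd) index the bottom (top) arcs; a layer ordering
-- is valid iff each of the two families of arcs is noncrossing and both
-- neighbours of face 2j+1 lie to its right (j even) or to its left (j odd).
-- Build the strip from its right end by prepending a block e, o to a valid
-- ordering whose first face is t.  Up to a reflection of the stack we may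
-- assume that o lies left of t and e.  Then o is forced to be the left
-- neighbour of t, because the face left of t, if any, starts a top arc that
-- passes over t; and e may go into any gap right of o that is exposed, i.e. not
-- covered by a bottom arc.  If there are p exposed gaps strictly right of t and
-- q strictly left of the gap just before t, then e has p + 1 choices, and after
-- the step there are q + 1 exposed gaps on the one side of e and any number
-- p′ ≤ p on the other.  The sides thus evolve independently, each as a Catalan
-- generating tree, and take turns.
module Submission where

open import Defs
open import Data.Bool using (Bool; true; false; not; if_then_else_)
open import Data.Empty using (⊥; ⊥-elim)
open import Data.Fin using (Fin; toℕ; fromℕ<; inject₁; zero; suc)
open import Data.Fin.Properties using (toℕ-injective; toℕ-fromℕ<; toℕ≤pred[n])
open import Data.List as List using (List; []; _∷_; _++_; length; concatMap)
open import Data.List.Membership.Propositional using (_∈_)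
open import Data.List.Membership.Propositional.Properties using (∈-map⁺; ∈-map⁻; ∈-concatMap⁺)
open import Data.List.Properties using (length-map; map-∘; map-cong; map-++)
open import Data.List.Relation.Unary.All as ListAll using ([]; _∷_)
import Data.List.Relation.Unary.All.Properties as ListAll
open import Data.List.Relation.Unary.AllPairs as ListAllPairs using (AllPairs; []; _∷_)
import Data.List.Relation.Unary.AllPairs.Properties as ListAllPairs
open import Data.List.Relation.Unary.Any as Any using (here; there)
open import Data.Nat
open import Data.Nat.Combinatorics using (_C_; nCk+nC[k+1]≡[n+1]C[k+1])
open import Data.Nat.Combinatorics.Specification using (k>n⇒nCk≡0)
open import Data.Nat.DivMod using (m*n/n≡m)
open import Data.Nat.ListAction using (sum)
open import Data.Nat.ListAction.Properties using (sum-++)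
open import Data.Nat.Properties
open import Data.Nat.Solver using (module +-*-Solver)
open import Data.Product using (∃; ∃₂; _×_; _,_; proj₁; proj₂)
open import Data.Sum using (_⊎_; inj₁; inj₂; [_,_]′)
open import Data.Unit using (⊤)
open import Data.Vec using (Vec; []; _∷_; map; head; tail; lookup)
import Data.Vec.Properties as Vec
open import Data.Vec.Relation.Unary.All as All using (All; []; _∷_)
import Data.Vec.Relation.Unary.All.Properties as All
open import Data.Vec.Relation.Unary.AllPairs using ([]; _∷_)
open import Data.Vec.Relation.Unary.Unique.Propositional using (Unique)
import Data.Vec.Relation.Unary.Unique.Propositional.Properties as Unique
open import Function using (_∘_; id; _on_; _⇔_; mk⇔)
open import Function.Construct.Composition using (_⇔-∘_)
open import Function.Construct.Symmetry using (⇔-sym)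
open import Level using (Level)
open import Relation.Binary using (Rel)
open import Relation.Binary.Definitions using (tri<; tri≈; tri>)
open import Relation.Binary.PropositionalEquality
open import Relation.Nullary using (yes; no; contradiction)
open import Relation.Unary using (Pred)
open +-*-Solver using (solve; _:+_; _:*_; _:=_; con)

-- Ballot numbers

-- The number of walks with steps +1 and -1 that start at height 0, never go below it and stand at
-- height `p` after `2 * k + p` steps; the recursion splits by the last step.
ballot : ℕ → ℕ → ℕ
ballot zero    p       = 1
ballot (suc k) zero    = ballot k 1
ballot (suc k) (suc p) = ballot (suc k) p + ballot k (2 + p)

-- A truncated predecessor would give `n C 0`, that is 1, at `k = 0`, where Pascal's rule needs 0.
_C-pred_ : ℕ → ℕ → ℕ
n C-pred zero  = 0
n C-pred suc k = n C k

nC-pred+nCk≡[n+1]Ck : ∀ n k → n C-pred k + n C k ≡ suc n C k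
nC-pred+nCk≡[n+1]Ck n zero    = refl
nC-pred+nCk≡[n+1]Ck n (suc k) = nCk+nC[k+1]≡[n+1]C[k+1] n k

[k+1]*[n+1]C[k+1]≡[n+1]*nCk : ∀ n k → suc k * (suc n C suc k) ≡ suc n * (n C k)
[k+1]*[n+1]C[k+1]≡[n+1]*nCk zero    zero    = refl
[k+1]*[n+1]C[k+1]≡[n+1]*nCk zero    (suc k) = begin
  (2 + k) * (1 C (2 + k))  ≡⟨ cong ((2 + k) *_) (k>n⇒nCk≡0 {1} {2 + k} (s≤s (s≤s z≤n))) ⟩
  (2 + k) * 0              ≡⟨ *-zeroʳ (2 + k) ⟩
  0                        ≡⟨ cong (_+ 0) (k>n⇒nCk≡0 {0} {suc k} (s≤s z≤n)) ⟨
  1 * (0 C suc k)          ∎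
  where open ≡-Reasoning
[k+1]*[n+1]C[k+1]≡[n+1]*nCk (suc n) zero    = begin
  1 * ((2 + n) C 1)                 ≡⟨ *-identityˡ _ ⟩
  (2 + n) C 1                       ≡⟨ nCk+nC[k+1]≡[n+1]C[k+1] (suc n) 0 ⟨
  1 + suc n C 1                     ≡⟨ cong suc (*-identityˡ (suc n C 1)) ⟨
  1 + 1 * (suc n C 1)               ≡⟨ cong suc ([k+1]*[n+1]C[k+1]≡[n+1]*nCk n zero) ⟩
  (2 + n) * 1                       ∎
  where open ≡-Reasoning
[k+1]*[n+1]C[k+1]≡[n+1]*nCk (suc n) (suc k) = begin
  (2 + k) * ((2 + n) C (2 + k))
    ≡⟨ cong ((2 + k) *_) (nCk+nC[k+1]≡[n+1]C[k+1] (suc n) (suc k)) ⟨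
  (2 + k) * (x + y)
    ≡⟨ solve 3 (λ k x y → (con 2 :+ k) :* (x :+ y)
                 := x :+ ((con 1 :+ k) :* x :+ (con 2 :+ k) :* y)) refl k x y ⟩
  x + (suc k * x + (2 + k) * y)
    ≡⟨ cong (x +_) (cong₂ _+_ ([k+1]*[n+1]C[k+1]≡[n+1]*nCk n k)
                              ([k+1]*[n+1]C[k+1]≡[n+1]*nCk n (suc k))) ⟩
  x + (suc n * (n C k) + suc n * (n C suc k))
    ≡⟨ cong (x +_) (*-distribˡ-+ (suc n) (n C k) (n C suc k)) ⟨
  x + suc n * (n C k + n C suc k)
    ≡⟨ cong (λ z → x + suc n * z) (nCk+nC[k+1]≡[n+1]C[k+1] n k) ⟩
  (2 + n) * x
    ∎
  where
  open ≡-Reasoning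
  x y : ℕ
  x = suc n C suc k
  y = suc n C (2 + k)

[2k+1]Ck≡[2k+1]C[k+1] : ∀ k → suc (2 * k) C k ≡ suc (2 * k) C suc k
[2k+1]Ck≡[2k+1]C[k+1] k = +-cancelˡ-≡ a a b (*-cancelˡ-≡ _ _ (suc k) (begin
  suc k * (a + a)           ≡⟨ solve 2 (λ k a → (con 1 :+ k) :* (a :+ a)
                                         := (con 2 :+ con 2 :* k) :* a) refl k a ⟩
  (2 + 2 * k) * a           ≡⟨ [k+1]*[n+1]C[k+1]≡[n+1]*nCk (suc (2 * k)) k ⟨
  suc k * ((2 + 2 * k) C suc k)
    ≡⟨ cong (suc k *_) (nCk+nC[k+1]≡[n+1]C[k+1] (suc (2 * k)) k) ⟨
  suc k * (a + b)           ∎))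
  where
  open ≡-Reasoning
  a b : ℕ
  a = suc (2 * k) C k
  b = suc (2 * k) C suc k

-- The reflection formula for ballot numbers, kept additive to avoid truncated subtraction.
-- Induction along Pascal's rule; the boundary `p = 0` needs the equality of the two middle
-- coefficients of row `suc (2 * k)`.
ballot+nC-pred≡nCk : ∀ k p → ballot k p + (2 * k + p) C-pred k ≡ (2 * k + p) C k
ballot+nC-pred≡nCk zero    p    = refl
ballot+nC-pred≡nCk (suc k) zero = begin
  ballot k 1 + N′ C k               ≡⟨ cong (λ n → ballot k 1 + n C k) eq ⟩
  ballot k 1 + suc N C k            ≡⟨ cong (ballot k 1 +_) (nC-pred+nCk≡[n+1]Ck N k) ⟨
  ballot k 1 + (N C-pred k + N C k) ≡⟨ +-assoc (ballot k 1) _ _ ⟨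
  ballot k 1 + N C-pred k + N C k
    ≡⟨ cong (_+ N C k) (subst (λ n → ballot k 1 + n C-pred k ≡ n C k) (+-comm (2 * k) 1)
                              (ballot+nC-pred≡nCk k 1)) ⟩
  N C k + N C k                     ≡⟨ cong (N C k +_) ([2k+1]Ck≡[2k+1]C[k+1] k) ⟩
  N C k + N C suc k                 ≡⟨ nCk+nC[k+1]≡[n+1]C[k+1] N k ⟩
  suc N C suc k                     ≡⟨ cong (_C suc k) eq ⟨
  N′ C suc k                        ∎
  where
  open ≡-Reasoning
  N N′ : ℕ
  N  = suc (2 * k)
  N′ = 2 * suc k + 0
  eq : N′ ≡ suc N
  eq = solve 1 (λ k → con 2 :* (con 1 :+ k) :+ con 0 := con 2 :+ con 2 :* k) refl k
ballot+nC-pred≡nCk (suc k) (suc p) = begin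
  (b₁ + b₂) + N′ C k                      ≡⟨ cong (λ n → (b₁ + b₂) + n C k) eq ⟩
  (b₁ + b₂) + suc N C k                   ≡⟨ cong ((b₁ + b₂) +_) (nC-pred+nCk≡[n+1]Ck N k) ⟨
  (b₁ + b₂) + (N C-pred k + N C k)
    ≡⟨ solve 4 (λ a b c d → (a :+ b) :+ (c :+ d) := (b :+ c) :+ (a :+ d)) refl b₁ b₂ _ _ ⟩
  (b₂ + N C-pred k) + (b₁ + N C k)
    ≡⟨ cong₂ _+_ (subst (λ n → b₂ + n C-pred k ≡ n C k) eq₂ (ballot+nC-pred≡nCk k (2 + p)))
                 (subst (λ n → b₁ + n C k ≡ n C suc k) eq₁ (ballot+nC-pred≡nCk (suc k) p)) ⟩
  N C k + N C suc k                       ≡⟨ nCk+nC[k+1]≡[n+1]C[k+1] N k ⟩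
  suc N C suc k                           ≡⟨ cong (_C suc k) eq ⟨
  N′ C suc k                              ∎
  where
  open ≡-Reasoning
  b₁ b₂ N N′ : ℕ
  b₁ = ballot (suc k) p
  b₂ = ballot k (2 + p)
  N  = 2 + (2 * k + p)
  N′ = 2 * suc k + suc p
  eq : N′ ≡ suc N
  eq = solve 2 (λ k p → con 2 :* (con 1 :+ k) :+ (con 1 :+ p)
                        := con 3 :+ (con 2 :* k :+ p)) refl k p
  eq₁ : 2 * suc k + p ≡ N
  eq₁ = solve 2 (λ k p → con 2 :* (con 1 :+ k) :+ p := con 2 :+ (con 2 :* k :+ p)) refl k p
  eq₂ : 2 * k + (2 + p) ≡ N
  eq₂ = solve 2 (λ k p → con 2 :* k :+ (con 2 :+ p) := con 2 :+ (con 2 :* k :+ p)) refl k p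

[k+2]*nC-pred≡k*nCk : ∀ k → (2 + k) * (suc (2 * k) C-pred k) ≡ k * (suc (2 * k) C k)
[k+2]*nC-pred≡k*nCk zero    = refl
[k+2]*nC-pred≡k*nCk (suc k) = +-cancelˡ-≡ (suc k * l) _ _ (begin
  suc k * l + (3 + k) * l
    ≡⟨ solve 2 (λ k l → (con 1 :+ k) :* l :+ (con 3 :+ k) :* l
                 := (con 2 :+ con 2 :* (con 1 :+ k)) :* l) refl k l ⟩
  suc N * l                         ≡⟨ [k+1]*[n+1]C[k+1]≡[n+1]*nCk N k ⟨
  suc k * (suc N C suc k)           ≡⟨ cong (suc k *_) (nCk+nC[k+1]≡[n+1]C[k+1] N k) ⟨
  suc k * (l + N C suc k)           ≡⟨ *-distribˡ-+ (suc k) l _ ⟩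
  suc k * l + suc k * (N C suc k)   ∎)
  where
  open ≡-Reasoning
  N l : ℕ
  N = suc (2 * suc k)
  l = N C k

ballot≡catalan : ∀ k → ballot k 1 ≡ catalan (k + 1)
ballot≡catalan k = sym (begin
  catalan (k + 1)                       ≡⟨ cong catalan (+-comm k 1) ⟩
  ((2 * suc k) C suc k) / (2 + k)       ≡⟨ cong (_/ (2 + k)) (sym *-form) ⟩
  (ballot k 1 * (2 + k)) / (2 + k)      ≡⟨ m*n/n≡m (ballot k 1) (2 + k) ⟩
  ballot k 1                            ∎)
  where
  open ≡-Reasoning
  N a l : ℕ
  N = suc (2 * k)
  a = N C k
  l = N C-pred k
  b+l≡a : ballot k 1 + l ≡ a
  b+l≡a = subst (λ n → ballot k 1 + n C-pred k ≡ n C k) (+-comm (2 * k) 1) (ballot+nC-pred≡nCk k 1)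
  *-form : ballot k 1 * (2 + k) ≡ (2 * suc k) C suc k
  -- Adding `k * a` replaces a subtraction: it equals `(2 + k) * l`, which completes `ballot k 1` to
  -- `a`.
  *-form = +-cancelʳ-≡ (k * a) _ _ (begin
    ballot k 1 * (2 + k) + k * a        ≡⟨ cong (ballot k 1 * (2 + k) +_) ([k+2]*nC-pred≡k*nCk k) ⟨
    ballot k 1 * (2 + k) + (2 + k) * l
      ≡⟨ solve 3 (λ k b l → b :* (con 2 :+ k) :+ (con 2 :+ k) :* l
                   := (con 2 :+ k) :* (b :+ l)) refl k (ballot k 1) l ⟩
    (2 + k) * (ballot k 1 + l)          ≡⟨ cong ((2 + k) *_) b+l≡a ⟩
    (2 + k) * a
      ≡⟨ solve 2 (λ k a → (con 2 :+ k) :* a := a :+ a :+ k :* a) refl k a ⟩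
    a + a + k * a                       ≡⟨ cong (λ x → a + x + k * a) ([2k+1]Ck≡[2k+1]C[k+1] k) ⟩
    a + N C suc k + k * a               ≡⟨ cong (_+ k * a) (nCk+nC[k+1]≡[n+1]C[k+1] N k) ⟩
    suc N C suc k + k * a
      ≡⟨ cong (λ n → n C suc k + k * a)
              (solve 1 (λ k → con 2 :+ con 2 :* k := con 2 :* (con 1 :+ k)) refl k) ⟩
    (2 * suc k) C suc k + k * a         ∎)

-- Product formula for the generating tree.

-- The terms run from `p` down to 0, the order in which `suffixes` lists its ever shorter tails.
sumTo : ℕ → (ℕ → ℕ) → ℕ
sumTo zero    f = f 0
sumTo (suc p) f = f (suc p) + sumTo p f

sumTo-cong : ∀ p {f g} → (∀ x → f x ≡ g x) → sumTo p f ≡ sumTo p g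
sumTo-cong zero    eq = eq 0
sumTo-cong (suc p) eq = cong₂ _+_ (eq (suc p)) (sumTo-cong p eq)

sumTo-*ˡ : ∀ c p f → sumTo p (λ x → c * f x) ≡ c * sumTo p f
sumTo-*ˡ c zero    f = refl
sumTo-*ˡ c (suc p) f =
  trans (cong (c * f (suc p) +_) (sumTo-*ˡ c p f)) (sym (*-distribˡ-+ c (f (suc p)) (sumTo p f)))

-- The ballot recursion unrolled in `p`. In the tree: a choice leaves any `x ≤ p` gaps on its side,
-- and that side has grown by one when its turn comes again.
sumTo-ballot : ∀ k p → sumTo p (λ x → ballot k (suc x)) ≡ ballot (suc k) p
sumTo-ballot k zero    = refl
sumTo-ballot k (suc p) =
  trans (+-comm (ballot k (2 + p)) _) (cong (_+ ballot k (2 + p)) (sumTo-ballot k p))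

-- The number of orderings k blocks later, given p exposed gaps on the side of
-- the next choice and q on the other.
descendants : ℕ → ℕ → ℕ → ℕ
descendants zero    p q = 1
descendants (suc k) p q = sumTo p (descendants k (suc q))

-- Of the `k` remaining turns the side with `p` gaps takes the upper half and the other side the
-- lower half, having grown to `suc q` before its first turn. A step exchanges the two factors, and
-- its sum touches only one of them.
descendants-product : ∀ k p q →
  descendants k p q ≡ ballot ⌊ k /2⌋ (suc q) * ballot ⌈ k /2⌉ p
descendants-product zero    p q = refl
descendants-product (suc k) p q = begin
  sumTo p (descendants k (suc q))
    ≡⟨ sumTo-cong p (λ x → trans (descendants-product k (suc q) x)
                                 (*-comm (ballot ⌊ k /2⌋ (suc x)) (ballot ⌈ k /2⌉ (suc q)))) ⟩
  sumTo p (λ x → ballot ⌈ k /2⌉ (suc q) * ballot ⌊ k /2⌋ (suc x))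
    ≡⟨ sumTo-*ˡ (ballot ⌈ k /2⌉ (suc q)) p (λ x → ballot ⌊ k /2⌋ (suc x)) ⟩
  ballot ⌈ k /2⌉ (suc q) * sumTo p (λ x → ballot ⌊ k /2⌋ (suc x))
    ≡⟨ cong (ballot ⌈ k /2⌉ (suc q) *_) (sumTo-ballot ⌊ k /2⌋ p) ⟩
  ballot ⌈ k /2⌉ (suc q) * ballot (suc ⌊ k /2⌋) p
    ∎
  where open ≡-Reasoning

-- Arcs and sites

private variable
  n m N t g h e o x y z u w x′ y′ : ℕ
  b : Bool
  v : Vec ℕ n
  ℓ : Level
  A : Set ℓ

-- Arc true (false): a crease of even (odd) index, in either orientation.
data Arc : Bool → Vec ℕ n → ℕ → ℕ → Set where
  here  : Arc true (x ∷ y ∷ v) x y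
  here˘ : Arc true (x ∷ y ∷ v) y x
  odd   : Arc false v x y → Arc true (z ∷ v) x y
  even  : Arc true v x y → Arc false (z ∷ v) x y

arc-sym : Arc b v x y → Arc b v y x
arc-sym here     = here˘
arc-sym here˘    = here
arc-sym (odd a)  = odd (arc-sym a)
arc-sym (even a) = even (arc-sym a)

arc-map⁺ : (f : ℕ → ℕ) → Arc b v x y → Arc b (map f v) (f x) (f y)
arc-map⁺ f here     = here
arc-map⁺ f here˘    = here˘
arc-map⁺ f (odd a)  = odd (arc-map⁺ f a)
arc-map⁺ f (even a) = even (arc-map⁺ f a)

arc-map⁻ : (f : ℕ → ℕ) (v : Vec ℕ n) → Arc b (map f v) x y →
           ∃₂ λ x′ y′ → Arc b v x′ y′ × x ≡ f x′ × y ≡ f y′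
arc-map⁻ f (_ ∷ _ ∷ _) here  = _ , _ , here , refl , refl
arc-map⁻ f (_ ∷ _ ∷ _) here˘ = _ , _ , here˘ , refl , refl
arc-map⁻ f (_ ∷ v) (odd a)   with arc-map⁻ f v a
... | _ , _ , a′ , p , q = _ , _ , odd a′ , p , q
arc-map⁻ f (_ ∷ v) (even a)  with arc-map⁻ f v a
... | _ , _ , a′ , p , q = _ , _ , even a′ , p , q

arc-All : {P : ℕ → Set} → All P v → Arc b v x y → P x
arc-All (px ∷ _)      here     = px
arc-All (_ ∷ py ∷ _)  here˘    = py
arc-All (_ ∷ ps)      (odd a)  = arc-All ps a
arc-All (_ ∷ ps)      (even a) = arc-All ps a

-- A single chain covers all four rotations in `Crossing`, because `Arc` contains each arc in both
-- orientations and the two arcs may be exchanged.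
NonCrossing : Vec ℕ n → Set
NonCrossing v = ∀ {b x y u w} → Arc b v x y → Arc b v u w → x < u → u < y → y < w → ⊥

nonCrossing-tail² : NonCrossing (x ∷ y ∷ v) → NonCrossing v
nonCrossing-tail² nx {true}  a c = nx (odd (even a)) (odd (even c))
nonCrossing-tail² nx {false} a c = nx (even (odd a)) (even (odd c))

StrictlyMonotone : (ℕ → ℕ) → Set
StrictlyMonotone f = ∀ {x y} → x < y → f x < f y

module _ {f : ℕ → ℕ} (f-mono : StrictlyMonotone f) where

  reflects-< : f x < f y → x < y
  reflects-< {x} {y} fx<fy with <-cmp x y
  ... | tri< x<y _ _    = x<y
  ... | tri≈ _ refl _   = contradiction fx<fy (<-irrefl refl)
  ... | tri> _ _ y<x    = contradiction fx<fy (<-asym (f-mono y<x))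

  mono⇒injective : f x ≡ f y → x ≡ y
  mono⇒injective {x} {y} eq with <-cmp x y
  ... | tri< x<y _ _  = contradiction eq (<⇒≢ (f-mono x<y))
  ... | tri≈ _ x≡y _  = x≡y
  ... | tri> _ _ y<x  = contradiction (sym eq) (<⇒≢ (f-mono y<x))

  nonCrossing-map⁺ : NonCrossing v → NonCrossing (map f v)
  nonCrossing-map⁺ {v = v} nx a c p q r
    with _ , _ , a′ , refl , refl ← arc-map⁻ f v a
       | _ , _ , c′ , refl , refl ← arc-map⁻ f v c
    = nx a′ c′ (reflects-< p) (reflects-< q) (reflects-< r)

  nonCrossing-map⁻ : NonCrossing (map f v) → NonCrossing v
  nonCrossing-map⁻ nx a c p q r =
    nx (arc-map⁺ f a) (arc-map⁺ f c) (f-mono p) (f-mono q) (f-mono r)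

Under : MV → ℕ → ℕ → Set
Under M e o = o < e
Under V e o = e < o

opp : MV → MV
opp M = V
opp V = M

-- The parity of a crease flips the meaning of its label, so the two equal labels of a block put the
-- odd face `o` on the same side of both neighbours `e` and `t`.
Zigzag : MV → ∀ m → Vec ℕ (suc (m * 2)) → Set
Zigzag s zero    v               = ⊤
Zigzag s (suc m) (e ∷ o ∷ t ∷ v) = Under s e o × Under s t o × Zigzag (opp s) m (t ∷ v)

module _ {f : ℕ → ℕ} (f-mono : StrictlyMonotone f) where

  under-map⁺ : ∀ s → Under s x y → Under s (f x) (f y)
  under-map⁺ M = f-mono
  under-map⁺ V = f-mono

  under-map⁻ : ∀ s → Under s (f x) (f y) → Under s x y
  under-map⁻ M = reflects-< f-mono
  under-map⁻ V = reflects-< f-mono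

  zigzag-map⁺ : ∀ s m {v} → Zigzag s m v → Zigzag s m (map f v)
  zigzag-map⁺ s zero    _ = _
  zigzag-map⁺ s (suc m) {_ ∷ _ ∷ _ ∷ _} (p , q , r) =
    under-map⁺ s p , under-map⁺ s q , zigzag-map⁺ (opp s) m r

  zigzag-map⁻ : ∀ s m {v} → Zigzag s m (map f v) → Zigzag s m v
  zigzag-map⁻ s zero    _ = _
  zigzag-map⁻ s (suc m) {_ ∷ _ ∷ _ ∷ _} (p , q , r) =
    under-map⁻ s p , under-map⁻ s q , zigzag-map⁻ (opp s) m r

record Valid (s : MV) (m : ℕ) (v : Vec ℕ (suc (m * 2))) : Set where
  constructor mkValid
  field
    unique      : Unique v
    bounded     : All (_≤ m * 2) v
    zigzag      : Zigzag s m v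
    nonCrossing : NonCrossing v

open Valid

-- Reflection of the stack.

mirror : ℕ → Vec ℕ n → Vec ℕ n
mirror N = map (N ∸_)

mirror-involutive : {v : Vec ℕ n} → All (_≤ N) v → mirror N (mirror N v) ≡ v
mirror-involutive []       = refl
mirror-involutive (p ∷ ps) = cong₂ _∷_ (m∸[m∸n]≡n p) (mirror-involutive ps)

mirror-injective : {v w : Vec ℕ n} → All (_≤ N) v → All (_≤ N) w →
                   mirror N v ≡ mirror N w → v ≡ w
mirror-injective {N = N} p q eq =
  trans (sym (mirror-involutive p)) (trans (cong (mirror N) eq) (mirror-involutive q))

mirror-bounded : (v : Vec ℕ n) → All (_≤ N) (mirror N v)
mirror-bounded {N = N} []      = []
mirror-bounded {N = N} (x ∷ v) = m∸n≤m N x ∷ mirror-bounded v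

mirror-unique : {v : Vec ℕ n} → All (_≤ N) v → Unique v → Unique (mirror N v)
mirror-unique []       []       = []
mirror-unique (p ∷ ps) (d ∷ ds) = apart p ps d ∷ mirror-unique ps ds
  where
  apart : ∀ {N n x} {v : Vec ℕ n} → x ≤ N → All (_≤ N) v → All (x ≢_) v →
          All (N ∸ x ≢_) (mirror N v)
  apart p []       []       = []
  apart p (q ∷ qs) (d ∷ ds) = (d ∘ ∸-cancelˡ-≡ p q) ∷ apart p qs ds

under-mirror : ∀ s → x ≤ N → y ≤ N → Under s x y → Under (opp s) (N ∸ x) (N ∸ y)
under-mirror M p q y<x = ∸-monoʳ-< y<x p
under-mirror V p q x<y = ∸-monoʳ-< x<y q

zigzag-mirror : ∀ s m {v} → All (_≤ N) v → Zigzag s m v → Zigzag (opp s) m (mirror N v)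
zigzag-mirror s zero    _ _ = _
zigzag-mirror s (suc m) {_ ∷ _ ∷ _ ∷ _} (pe ∷ po ∷ pt ∷ ps) (p , q , r) =
  under-mirror s pe po p , under-mirror s pt po q , zigzag-mirror (opp s) m (pt ∷ ps) r

nonCrossing-mirror : {v : Vec ℕ n} → NonCrossing v → NonCrossing (mirror N v)
nonCrossing-mirror {N = N} {v = v} nx a c p q r
  with _ , _ , a′ , refl , refl ← arc-map⁻ (N ∸_) v a
     | _ , _ , c′ , refl , refl ← arc-map⁻ (N ∸_) v c
  -- The chain read back through the reflection is reversed, so the two arcs change places and
  -- orientation.
  = nx (arc-sym c′) (arc-sym a′) (∸-cancelʳ-< r) (∸-cancelʳ-< q) (∸-cancelʳ-< p)

valid-mirror : ∀ s m {v} → Valid s m v → Valid (opp s) m (mirror (m * 2) v)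
valid-mirror s m {v} va = mkValid
  (mirror-unique (bounded va) (unique va))
  (mirror-bounded v)
  (zigzag-mirror s m (bounded va) (zigzag va))
  (nonCrossing-mirror (nonCrossing va))

-- The gap g of a stack lies just before position g.
Site : Vec ℕ n → ℕ → Set
Site v g = ∀ x y → Arc true v x y → x < g → y < g

-- The second component is what will force the position of the odd face: once a new first face
-- stands just after the gap, the top arc that opens at the face left of the gap passes over it.
-- `RightSite` is the mirror image.
LeftSite : Vec ℕ n → ℕ → Set
LeftSite v g = Site v g × (g ≡ 0 ⊎ ∃₂ λ x y → Arc false v x y × g ≡ suc x × x < y)

RightSite : ℕ → Vec ℕ n → ℕ → Set
RightSite N v g = Site v g × (g ≡ suc N ⊎ ∃₂ λ x y → Arc false v x y × g ≡ x × y < x)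

module _ {v : Vec ℕ n} (v≤N : All (_≤ N) v) where

  -- Positions reflect by `N ∸_` but gaps by `suc N ∸_`, since a stack with positions 0 to `N` has
  -- gaps 0 to `suc N`.
  site-mirror : Site v g → Site (mirror N v) (suc N ∸ g)
  site-mirror {g} s _ _ a p with x , y , a′ , refl , refl ← arc-map⁻ (N ∸_) v a
    with g ≤? y
  ... | yes g≤y = subst (_≤ suc N ∸ g) (+-∸-assoc 1 (arc-All v≤N (arc-sym a′))) (∸-monoʳ-≤ (suc N) g≤y)
  ... | no  g≰y = contradiction (∸-monoʳ-≤ (suc N) (s _ _ (arc-sym a′) (≰⇒> g≰y))) (<⇒≱ p)

  leftSite-mirror : LeftSite v g → RightSite N (mirror N v) (suc N ∸ g)
  leftSite-mirror (s , inj₁ refl) = site-mirror s , inj₁ refl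
  leftSite-mirror (s , inj₂ (x , y , a , refl , x<y)) =
    site-mirror s ,
    inj₂ (_ , _ , arc-map⁺ (N ∸_) a , refl , ∸-monoʳ-< x<y (arc-All v≤N (arc-sym a)))

  rightSite-mirror : RightSite N v g → LeftSite (mirror N v) (suc N ∸ g)
  rightSite-mirror (s , inj₁ refl) = site-mirror s , inj₁ (n∸n≡0 (suc N))
  rightSite-mirror (s , inj₂ (x , y , a , refl , y<x)) =
    site-mirror s ,
    inj₂ (_ , _ , arc-map⁺ (N ∸_) a , +-∸-assoc 1 (arc-All v≤N a) , ∸-monoʳ-< y<x (arc-All v≤N a))

-- Insertion of a block

Encloses : ℕ → ℕ → Bool → Vec ℕ n → Set
Encloses p q b v = ∀ {x y} → Arc b v x y → p < x → x < q → p < y × y < q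

module _ {p q : ℕ} {v : Vec ℕ n} (enc : Encloses p q b v) where

  encloses⇒¬leaves : Arc b v u w → p < u → u < q → q < w → ⊥
  encloses⇒¬leaves a p<u u<q q<w = <-asym q<w (proj₂ (enc a p<u u<q))

  encloses⇒¬enters : Arc b v x y → x < p → p < y → y < q → ⊥
  encloses⇒¬enters a x<p p<y y<q = <-asym x<p (proj₁ (enc (arc-sym a) p<y y<q))

-- Only arcs of the same kind can cross, so the new bottom arc `o e` meets bottom arcs and the new
-- top arc `o t` meets top arcs. A chain that reads a new arc from right to left contradicts `o<e`
-- or `o<t`.
nonCrossing-∷∷ : {v : Vec ℕ n} → o < e → o < t →
  Encloses o e true (t ∷ v) → Encloses o t false (t ∷ v) →
  NonCrossing (t ∷ v) → NonCrossing (e ∷ o ∷ t ∷ v)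
nonCrossing-∷∷ o<e o<t encᵉ encᵒ nx = λ where
  here  here  p q r → <-irrefl refl p
  here  here˘ p q r → <-irrefl refl q
  here˘ here  p q r → <-irrefl refl q
  here˘ here˘ p q r → <-irrefl refl p
  here  (odd (even c)) p q r → <-asym o<e (<-trans p q)
  here˘ (odd (even c)) p q r → encloses⇒¬leaves encᵉ c p q r
  (odd (even a)) here  p q r → <-asym o<e (<-trans q r)
  (odd (even a)) here˘ p q r → encloses⇒¬enters encᵉ a p q r
  (odd (even a)) (odd (even c)) p q r → nx a c p q r
  (even here)  (even here)  p q r → <-irrefl refl p
  (even here)  (even here˘) p q r → <-irrefl refl q
  (even here˘) (even here)  p q r → <-irrefl refl q
  (even here˘) (even here˘) p q r → <-irrefl refl p
  (even here)  (even (odd c)) p q r → encloses⇒¬leaves encᵒ c p q r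
  (even here˘) (even (odd c)) p q r → <-asym o<t (<-trans p q)
  (even (odd a)) (even here)  p q r → encloses⇒¬enters encᵒ a p q r
  (even (odd a)) (even here˘) p q r → <-asym o<t (<-trans q r)
  (even (odd a)) (even (odd c)) p q r → nx a c p q r

-- The graph of `spread` as a relation, so that inequalities follow by matching on the stretch in
-- which a position lies. As `high` records both bounds, totality, uniqueness and monotonicity hold
-- without `t ≤ g`.
data Shift (t g : ℕ) : ℕ → ℕ → Set where
  low  : x < t → Shift t g x x
  mid  : t ≤ x → x < g → Shift t g x (suc x)
  high : t ≤ x → g ≤ x → Shift t g x (2 + x)

shift : ∀ t g x → ∃ (Shift t g x)
shift t g x with x <? t
... | yes x<t = _ , low x<t
... | no  x≮t with x <? g
...   | yes x<g = _ , mid (≮⇒≥ x≮t) x<g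
...   | no  x≮g = _ , high (≮⇒≥ x≮t) (≮⇒≥ x≮g)

unshift : t ≤ g → ∀ y → y ≢ t → y ≢ suc g → ∃ λ x → Shift t g x y
unshift {t} {g} t≤g y y≢t y≢g+1 with y <? t
... | yes y<t = _ , low y<t
... | no  y≮t with ≤∧≢⇒< (≮⇒≥ y≮t) (y≢t ∘ sym)
...   | s≤s {n = x} t≤x with x <? g
...     | yes x<g = _ , mid t≤x x<g
...     | no  x≮g with ≤∧≢⇒< (≮⇒≥ x≮g) (λ g≡x → y≢g+1 (cong suc (sym g≡x)))
...       | s≤s g≤x = _ , high (≤-trans t≤g g≤x) g≤x

shift-unique : Shift t g x y → Shift t g x y′ → y ≡ y′
shift-unique (low _)    (low _)    = refl
shift-unique (low p)    (mid q _)  = contradiction p (≤⇒≯ q)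
shift-unique (low p)    (high q _) = contradiction p (≤⇒≯ q)
shift-unique (mid q _)  (low p)    = contradiction p (≤⇒≯ q)
shift-unique (mid _ _)  (mid _ _)  = refl
shift-unique (mid _ p)  (high _ q) = contradiction p (≤⇒≯ q)
shift-unique (high q _) (low p)    = contradiction p (≤⇒≯ q)
shift-unique (high _ q) (mid _ p)  = contradiction p (≤⇒≯ q)
shift-unique (high _ _) (high _ _) = refl

shift-mono : Shift t g x x′ → Shift t g y y′ → x < y → x′ < y′
shift-mono (low _)    (low _)    x<y = x<y
shift-mono (low _)    (mid _ _)  x<y = m<n⇒m<1+n x<y
shift-mono (low _)    (high _ _) x<y = m<n⇒m<1+n (m<n⇒m<1+n x<y)
shift-mono (mid p _)  (low q)    x<y = contradiction (<-trans x<y q) (≤⇒≯ p)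
shift-mono (mid _ _)  (mid _ _)  x<y = s<s x<y
shift-mono (mid _ _)  (high _ _) x<y = s<s (m<n⇒m<1+n x<y)
shift-mono (high p _) (low q)    x<y = contradiction (<-trans x<y q) (≤⇒≯ p)
shift-mono (high _ p) (mid _ q)  x<y = contradiction (<-trans x<y q) (≤⇒≯ p)
shift-mono (high _ _) (high _ _) x<y = s<s (s<s x<y)

shift-≤ : Shift t g x y → y ≤ 2 + x
shift-≤ (low _)    = m≤n+m _ 2
shift-≤ (mid _ _)  = m≤n+m _ 1
shift-≤ (high _ _) = ≤-refl

-- The order-preserving embedding ℕ → ℕ that misses exactly t and suc g.
abstract
  spread : ℕ → ℕ → ℕ → ℕ
  spread t g x = proj₁ (shift t g x)

  spread-shift : ∀ t g x → Shift t g x (spread t g x)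
  spread-shift t g x = proj₂ (shift t g x)

spread-mono : ∀ t g → StrictlyMonotone (spread t g)
spread-mono t g = shift-mono (spread-shift t g _) (spread-shift t g _)

module _ (t≤g : t ≤ g) where

  shift-≢t : Shift t g x y → t ≢ y
  shift-≢t (low p)    = ≢-sym (<⇒≢ p)
  shift-≢t (mid p _)  = <⇒≢ (s≤s p)
  shift-≢t (high p _) = <⇒≢ (m<n⇒m<1+n (s≤s p))

  shift-≢g+1 : Shift t g x y → suc g ≢ y
  shift-≢g+1 (low p)    = ≢-sym (<⇒≢ (m<n⇒m<1+n (<-≤-trans p t≤g)))
  shift-≢g+1 (mid _ p)  = ≢-sym (<⇒≢ (s<s p))
  shift-≢g+1 (high _ p) = <⇒≢ (s<s (s≤s p))

  shift-<low⁺ : h ≤ t → Shift t g x y → x < h → y < h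
  shift-<low⁺ h≤t (low _)    x<h = x<h
  shift-<low⁺ h≤t (mid p _)  x<h = contradiction (<-≤-trans x<h h≤t) (≤⇒≯ p)
  shift-<low⁺ h≤t (high p _) x<h = contradiction (<-≤-trans x<h h≤t) (≤⇒≯ p)

  shift-<low⁻ : h ≤ t → Shift t g x y → y < h → x < h
  shift-<low⁻ h≤t (low _)    y<h = y<h
  shift-<low⁻ h≤t (mid _ _)  y<h = <⇒≤ y<h
  shift-<low⁻ h≤t (high _ _) y<h = <⇒≤ (<⇒≤ y<h)

  shift-<high⁺ : g ≤ h → Shift t g x y → x < h → y < 2 + h
  shift-<high⁺ g≤h s x<h = ≤-<-trans (shift-≤ s) (s<s (s<s x<h))

  shift-<high⁻ : g ≤ h → Shift t g x y → y < 2 + h → x < h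
  shift-<high⁻ g≤h (low p)    y<h = <-≤-trans p (≤-trans t≤g g≤h)
  shift-<high⁻ g≤h (mid _ p)  y<h = <-≤-trans p g≤h
  shift-<high⁻ g≤h (high _ _) y<h = s<s⁻¹ (s<s⁻¹ y<h)

  shift-low : x < t → Shift t g x y → y ≡ x
  shift-low x<t s = shift-unique s (low x<t)

  shift-high : g ≤ x → Shift t g x y → y ≡ 2 + x
  shift-high g≤x s = shift-unique s (high (≤-trans t≤g g≤x) g≤x)

  t<shift⁺ : Shift t g x y → t ≤ x → t < y
  t<shift⁺ (low p)    t≤x = contradiction p (≤⇒≯ t≤x)
  t<shift⁺ (mid _ _)  t≤x = s≤s t≤x
  t<shift⁺ (high _ _) t≤x = m<n⇒m<1+n (s≤s t≤x)

  t<shift⁻ : Shift t g x y → t < y → t ≤ x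
  t<shift⁻ (low p)    t<y = <⇒≤ t<y
  t<shift⁻ (mid p _)  t<y = p
  t<shift⁻ (high p _) t<y = p

  shift<g+1⁺ : Shift t g x y → x < g → y < suc g
  shift<g+1⁺ (low _)    x<g = m<n⇒m<1+n x<g
  shift<g+1⁺ (mid _ _)  x<g = s<s x<g
  shift<g+1⁺ (high _ p) x<g = contradiction x<g (≤⇒≯ p)

  shift<g+1⁻ : Shift t g x y → y < suc g → x < g
  shift<g+1⁻ (low p)    y< = <-≤-trans p t≤g
  shift<g+1⁻ (mid _ p)  y< = p
  shift<g+1⁻ (high _ p) y< = contradiction p (<⇒≱ (<-trans (n<1+n _) (s<s⁻¹ y<)))

-- The new odd face goes into gap t, the new even face into gap g ≥ t of v; the
-- former pushes the latter to position suc g.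
insert : ℕ → ℕ → Vec ℕ n → Vec ℕ (2 + n)
insert t g v = suc g ∷ t ∷ map (spread t g) v

module _ {v : Vec ℕ n} (t≤g : t ≤ g) where

  private
    ev : Arc b v x y → Arc b (insert t g v) (spread t g x) (spread t g y)
    ev {true}  a = odd (even (arc-map⁺ (spread t g) a))
    ev {false} a = even (odd (arc-map⁺ (spread t g) a))

  site-insert-low : h ≤ t → Site v h → Site (insert t g v) h
  site-insert-low h≤t s _ _ here  p = contradiction (<⇒≤ p) (<⇒≱ (≤-<-trans (≤-trans h≤t t≤g) (n<1+n g)))
  site-insert-low h≤t s _ _ here˘ p = contradiction h≤t (<⇒≱ p)
  site-insert-low h≤t s _ _ (odd (even a)) p
    with _ , _ , a′ , refl , refl ← arc-map⁻ (spread t g) v a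
    = shift-<low⁺ t≤g h≤t (spread-shift t g _) (s _ _ a′ (shift-<low⁻ t≤g h≤t (spread-shift t g _) p))

  site-insert-high : g ≤ h → Site v h → Site (insert t g v) (2 + h)
  site-insert-high g≤h s _ _ here  p = s≤s (≤-trans (≤-trans t≤g g≤h) (n≤1+n _))
  site-insert-high g≤h s _ _ here˘ p = s≤s (s≤s g≤h)
  site-insert-high g≤h s _ _ (odd (even a)) p
    with _ , _ , a′ , refl , refl ← arc-map⁻ (spread t g) v a
    = shift-<high⁺ t≤g g≤h (spread-shift t g _) (s _ _ a′ (shift-<high⁻ t≤g g≤h (spread-shift t g _) p))

  -- The new bottom arc joins `t` and `suc g` and covers exactly the gaps from `suc t` to `suc g`.
  -- The gaps outside move by 0 or 2, and for them the old arcs decide.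
  site-insert⁻ : Site (insert t g v) h →
    (h ≤ t × Site v h) ⊎ (∃ λ h′ → h ≡ 2 + h′ × g ≤ h′ × Site v h′)
  site-insert⁻ {h} s with h ≤? t
  ... | yes h≤t = inj₁ (h≤t , λ _ _ a p →
          shift-<low⁻ t≤g h≤t (spread-shift t g _) (s _ _ (ev a) (shift-<low⁺ t≤g h≤t (spread-shift t g _) p)))
  ... | no  h≰t with s≤s (s≤s g≤h) ← s _ _ here˘ (≰⇒> h≰t) = inj₂ (_ , refl , g≤h , λ _ _ a p →
          shift-<high⁻ t≤g g≤h (spread-shift t g _) (s _ _ (ev a) (shift-<high⁺ t≤g g≤h (spread-shift t g _) p)))

  leftSite-insert : h ≤ t → LeftSite v h → LeftSite (insert t g v) h
  leftSite-insert h≤t (s , inj₁ refl) = site-insert-low h≤t s , inj₁ refl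
  leftSite-insert h≤t (s , inj₂ (x , y , a , refl , x<y)) =
    site-insert-low h≤t s ,
    inj₂ (_ , _ , ev a , cong suc (sym (shift-low t≤g h≤t (spread-shift t g x))) , spread-mono t g x<y)

  rightSite-insert : g ≤ h → RightSite N v h → RightSite (2 + N) (insert t g v) (2 + h)
  rightSite-insert g≤h (s , inj₁ refl) = site-insert-high g≤h s , inj₁ refl
  rightSite-insert g≤h (s , inj₂ (x , y , a , refl , y<x)) =
    site-insert-high g≤h s ,
    inj₂ (_ , _ , ev a , sym (shift-high t≤g g≤h (spread-shift t g x)) , spread-mono t g y<x)

-- When `e` enters the same gap as `o`, the gap after `e` lies just before the old first face, and
-- the new top arc from that face back to `o` is the required witness.
rightSite-insert-tip : {v : Vec ℕ n} → Site (t ∷ v) t → RightSite N (insert t t (t ∷ v)) (2 + t)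
rightSite-insert-tip {t = t} s =
  site-insert-high ≤-refl ≤-refl s ,
  inj₂ (_ , _ , even here˘ , sym (shift-high ≤-refl ≤-refl (spread-shift t t t)) ,
        t<shift⁺ ≤-refl (spread-shift t t t) ≤-refl)

insert-bounded : t ≤ suc N → g ≤ suc N → All (_≤ N) v → All (_≤ 2 + N) (insert t g v)
insert-bounded {t} {N} {g} t≤ g≤ v≤ = s≤s g≤ ∷ ≤-trans t≤ (n≤1+n (suc N)) ∷
  All.map⁺ (All.map (λ p → ≤-trans (shift-≤ (spread-shift t g _)) (s≤s (s≤s p))) v≤)

-- Both gaps are exposed, so no old bottom arc leaves the interval between `o` and `e`. No old face
-- lies between `o` and the old first face, so the new top arc crosses nothing.
valid-insert : {v : Vec ℕ (m * 2)} → t ≤ g → g ≤ suc (m * 2) →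
  Site (t ∷ v) t → Site (t ∷ v) g →
  Valid V m (t ∷ v) → Valid M (suc m) (insert t g (t ∷ v))
valid-insert {m} {t} {g} {v} t≤g g≤ st sg va = mkValid
  ((≢-sym (<⇒≢ (s≤s t≤g)) ∷ avoid (shift-≢g+1 t≤g (spread-shift t g _))) ∷
   avoid (shift-≢t t≤g (spread-shift t g _)) ∷
   Unique.map⁺ (mono⇒injective (spread-mono t g)) (unique va))
  (insert-bounded (≤-trans t≤g g≤) g≤ (bounded va))
  (s≤s t≤g , t<ft , zigzag-map⁺ (spread-mono t g) V m (zigzag va))
  (nonCrossing-∷∷ (s≤s t≤g) t<ft encᵉ encᵒ (nonCrossing-map⁺ (spread-mono t g) (nonCrossing va)))
  where
  f : ℕ → ℕ
  f = spread t g
  t<ft : t < f t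
  t<ft = t<shift⁺ t≤g (spread-shift t g t) ≤-refl
  avoid : {y : ℕ} → (∀ {x} → y ≢ f x) → All (y ≢_) (map f (t ∷ v))
  avoid p = All.map⁺ (All.universal (λ _ → p) (t ∷ v))
  encᵉ : Encloses t (suc g) true (map f (t ∷ v))
  encᵉ a p q with x , y , a′ , refl , refl ← arc-map⁻ f (t ∷ v) a =
    t<shift⁺ t≤g (spread-shift t g y)
      (≮⇒≥ (λ y<t → <⇒≱ (st _ _ (arc-sym a′) y<t) (t<shift⁻ t≤g (spread-shift t g x) p))) ,
    shift<g+1⁺ t≤g (spread-shift t g y) (sg _ _ a′ (shift<g+1⁻ t≤g (spread-shift t g x) q))
  encᵒ : Encloses t (f t) false (map f (t ∷ v))
  encᵒ a p q with x , y , a′ , refl , refl ← arc-map⁻ f (t ∷ v) a =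
    contradiction (reflects-< (spread-mono t g) q) (≤⇒≯ (t<shift⁻ t≤g (spread-shift t g x) p))

-- The generating tree

suffixes : List A → List (A × List A)
suffixes []       = []
suffixes (x ∷ xs) = (x , xs) ∷ suffixes xs

suffix-All : ∀ {p} {P : Pred A p} {x xs ys} → ListAll.All P ys → (x , xs) ∈ suffixes ys → ListAll.All P (x ∷ xs)
suffix-All (p ∷ ps) (here refl) = p ∷ ps
suffix-All (p ∷ ps) (there i)   = suffix-All ps i

suffix-AllPairs : ∀ {r} {R : Rel A r} {x xs ys} → AllPairs R ys → (x , xs) ∈ suffixes ys → AllPairs R (x ∷ xs)
suffix-AllPairs (r ∷ rs) (here refl) = r ∷ rs
suffix-AllPairs (r ∷ rs) (there i)   = suffix-AllPairs rs i

suffixes-AllPairs : ∀ {r} {R : Rel A r} {ys} → AllPairs R ys → AllPairs (R on proj₁) (suffixes ys)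
suffixes-AllPairs []       = []
suffixes-AllPairs (r ∷ rs) =
  ListAll.tabulate (λ i → ListAll.head (suffix-All r i)) ∷ suffixes-AllPairs rs

∈⇒suffix : ∀ {x : A} {ys} → x ∈ ys → ∃ λ xs → (x , xs) ∈ suffixes ys
∈⇒suffix (here refl) = _ , here refl
∈⇒suffix (there i)   = _ , there (proj₂ (∈⇒suffix i))

suffix-∈-≥ : ∀ {x xs ys} → AllPairs _<_ ys → (x , xs) ∈ suffixes ys → y ∈ ys → x ≤ y → y ∈ x ∷ xs
suffix-∈-≥ (_ ∷ _)  (here refl) j           _   = j
suffix-∈-≥ (r ∷ _)  (there i)   (here refl) x≤y =
  contradiction x≤y (<⇒≱ (ListAll.head (suffix-All r i)))
suffix-∈-≥ (_ ∷ rs) (there i)   (there j)   x≤y = suffix-∈-≥ rs i j x≤y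

head-minimum : ∀ {x xs} → AllPairs _<_ (x ∷ xs) → ListAll.All (x ≤_) (x ∷ xs)
head-minimum (r ∷ _) = ≤-refl ∷ ListAll.map <⇒≤ r

AllPairs-zip-All : ∀ {p r} {P : Pred A p} {R : Rel A r} {xs} →
  ListAll.All P xs → AllPairs R xs → AllPairs (λ x y → P x × P y × R x y) xs
AllPairs-zip-All []       []       = []
AllPairs-zip-All (p ∷ ps) (r ∷ rs) =
  ListAll.zipWith (λ (q , s) → p , q , s) (ps , r) ∷ AllPairs-zip-All ps rs

ascending⇒descending : ∀ {xs} → ListAll.All (_≤ N) xs → AllPairs _<_ xs →
  AllPairs _>_ (List.map (N ∸_) xs)
ascending⇒descending ps rs = ListAllPairs.map⁺
  (ListAllPairs.map (λ (_ , q , r) → ∸-monoʳ-< r q) (AllPairs-zip-All ps rs))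

descending⇒ascending : ∀ {xs} → ListAll.All (_≤ N) xs → AllPairs _>_ xs →
  AllPairs _<_ (List.map (N ∸_) xs)
descending⇒ascending ps rs = ListAllPairs.map⁺
  (ListAllPairs.map (λ (p , _ , r) → ∸-monoʳ-< r p) (AllPairs-zip-All ps rs))

-- The sites of layers are lefts, the gap just before the first face, and
-- rights; both lists are ordered by increasing distance from that gap.
record State (m : ℕ) : Set where
  constructor ⟨_,_,_⟩
  field
    layers       : Vec ℕ (suc (m * 2))
    lefts rights : List ℕ

  tip : ℕ
  tip = head layers

open State

-- The gap of the tip is required to be a `LeftSite` only; when it is chosen for `e`,
-- `rightSite-insert-tip` supplies the missing witness. `complete` makes the lists exhaustive, which
-- surjectivity of the tree rests on.
record Invariant (st : State m) : Set where
  constructor mkInvariant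
  field
    valid       : Valid V m (layers st)
    leftSites   : ListAll.All (LeftSite (layers st)) (tip st ∷ lefts st)
    rightSites  : ListAll.All (RightSite (m * 2) (layers st)) (rights st)
    gaps        : ListAll.All (_≤ suc (m * 2)) (tip st ∷ rights st)
    descending  : AllPairs _>_ (tip st ∷ lefts st)
    ascending   : AllPairs _<_ (tip st ∷ rights st)
    complete    : h ≤ suc (m * 2) → Site (layers st) h → h ∈ lefts st ⊎ h ∈ tip st ∷ rights st

open Invariant

-- Inserting a block on the left yields a Valid M ordering; the reflection turns
-- it into a Valid V one and swaps the roles of the two lists of sites.
step : State m → ℕ × List ℕ → State (suc m)
step {m} st (g , gs) =
  ⟨ mirror (2 + m * 2) (insert (tip st) g (layers st))
  -- Insertion moves a gap `h` beyond `g` to `2 + h`, and `3 + m * 2 ∸ (2 + h)` computes to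
  -- `suc (m * 2) ∸ h`.
  , List.map (suc (m * 2) ∸_) gs
  , List.map (3 + m * 2 ∸_) (tip st ∷ lefts st) ⟩

-- Each gap comes with the gaps beyond it, the ones that remain strictly beyond `e` on its side.
choices : State m → List (ℕ × List ℕ)
choices st = suffixes (tip st ∷ rights st)

tip≤choice : ∀ {st : State m} {gs} → Invariant st → (g , gs) ∈ choices st → tip st ≤ g
tip≤choice inv i = ListAll.head (suffix-All (head-minimum (ascending inv)) i)

choice≤ : ∀ {st : State m} {gs} → Invariant st → (g , gs) ∈ choices st → g ≤ suc (m * 2)
choice≤ inv i = ListAll.head (suffix-All (gaps inv) i)

choice-bounded : ∀ {st : State m} {gs} → Invariant st → (g , gs) ∈ choices st →
  All (_≤ 2 + m * 2) (insert (tip st) g (layers st))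
choice-bounded inv i =
  insert-bounded (ListAll.head (gaps inv)) (choice≤ inv i) (bounded (valid inv))

invariant-step : ∀ {st : State m} {gs} → Invariant st → (g , gs) ∈ choices st →
  Invariant (step st (g , gs))
invariant-step {m} {g} {st = st@(⟨ t ∷ v , L , R ⟩)} {gs} inv i = mkInvariant
  (valid-mirror M (suc m) (valid-insert t≤g g≤ (proj₁ (ListAll.head (leftSites inv))) site-g (valid inv)))
  (ListAll.map⁺ (ListAll.map (rightSite-mirror bnd) (news inv i)))
  (ListAll.map⁺ (ListAll.map (leftSite-mirror bnd) (ListAll.zipWith
    (λ (h≤t , s) → leftSite-insert t≤g h≤t s) (lefts≤ , leftSites inv))))
  -- The gap before the new tip is the reflection of gap `2 + g`, the one just after `e`; hence the
  -- head `2 + g`.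
  (ListAll.map⁺ (ListAll.universal (m∸n≤m (3 + m * 2)) (2 + g ∷ t ∷ L)))
  (ascending⇒descending (suffix-All (gaps inv) i) asc)
  (descending⇒ascending
    (s≤s (s≤s g≤) ∷ ListAll.map (λ h≤t → ≤-trans h≤t (≤-trans t≤g (≤-trans g≤ (m≤n+m _ 2)))) lefts≤)
    (ListAll.map (λ h≤t → s≤s (≤-trans h≤t (≤-trans t≤g (n≤1+n g)))) lefts≤ ∷ descending inv))
  comp
  where
  t≤g : t ≤ g
  t≤g = tip≤choice inv i
  g≤ : g ≤ suc (m * 2)
  g≤ = choice≤ inv i
  bnd = choice-bounded inv i
  asc : AllPairs _<_ (g ∷ gs)
  asc = suffix-AllPairs (ascending inv) i
  site-g : Site (t ∷ v) g
  site-g = ListAll.head (suffix-All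
    (proj₁ (ListAll.head (leftSites inv)) ∷ ListAll.map proj₁ (rightSites inv)) i)
  lefts≤ : ListAll.All (_≤ t) (t ∷ L)
  lefts≤ = ≤-refl ∷ ListAll.map <⇒≤ (ListAllPairs.head (descending inv))
  -- Stated for arbitrary `t`, so that `here refl` can identify it with `g`.
  news : ∀ {m t v L R gs} → Invariant {m} ⟨ t ∷ v , L , R ⟩ → (g , gs) ∈ suffixes (t ∷ R) →
    ListAll.All (λ h → RightSite (2 + m * 2) (insert t g (t ∷ v)) (2 + h)) (g ∷ gs)
  news inv (here refl) = rightSite-insert-tip (proj₁ (ListAll.head (leftSites inv))) ∷
    ListAll.zipWith (λ (p , s) → rightSite-insert ≤-refl (<⇒≤ p) s)
      (ListAllPairs.head (ascending inv) , rightSites inv)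
  news inv (there i) = ListAll.zipWith
    (λ (p , s) → rightSite-insert (tip≤choice inv (there i)) p s)
    ( head-minimum (suffix-AllPairs (ascending inv) (there i))
    , suffix-All (rightSites inv) i)
  -- Reflect `h` back and apply `site-insert⁻`. A gap up to `t` is in `t ∷ L`, since no right gap
  -- but `t` is that small. A gap `2 + k` with `g ≤ k` comes from `g ∷ gs`: `k = g` gives the new
  -- tip, the others the new lefts.
  comp : ∀ {h} → h ≤ 3 + m * 2 → Site (mirror (2 + m * 2) (insert t g (t ∷ v))) h →
    h ∈ List.map (suc (m * 2) ∸_) gs ⊎ h ∈ List.map (3 + m * 2 ∸_) (2 + g ∷ t ∷ L)
  comp {h} h≤ s with site-insert⁻ t≤g (subst (λ w → Site w (3 + m * 2 ∸ h)) (mirror-involutive bnd)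
                       (site-mirror (mirror-bounded (insert t g (t ∷ v))) s))
  ... | inj₁ (k≤t , s′) = inj₂ (there (subst (_∈ List.map (3 + m * 2 ∸_) (t ∷ L)) (m∸[m∸n]≡n h≤)
          (∈-map⁺ (3 + m * 2 ∸_) (in-lefts k≤t (complete inv (≤-trans k≤t (ListAll.head (gaps inv))) s′)))))
    where
    in-lefts : ∀ {k} → k ≤ t → k ∈ L ⊎ k ∈ t ∷ R → k ∈ t ∷ L
    in-lefts _   (inj₁ j) = there j
    in-lefts k≤t (inj₂ j) = here (≤-antisym k≤t (ListAll.lookup (head-minimum (ascending inv)) j))
  ... | inj₂ (k , eq , g≤k , s′) = [ inj₂ ∘ here , inj₁ ]′ (split (∈-map⁺ (suc (m * 2) ∸_) in-rights))
    where
    h≡ : suc (m * 2) ∸ k ≡ h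
    h≡ = trans (sym (cong (3 + m * 2 ∸_) eq)) (m∸[m∸n]≡n h≤)
    split : suc (m * 2) ∸ k ∈ List.map (suc (m * 2) ∸_) (g ∷ gs) →
            h ≡ suc (m * 2) ∸ g ⊎ h ∈ List.map (suc (m * 2) ∸_) gs
    split (here p)  = inj₁ (trans (sym h≡) p)
    split (there p) = inj₂ (subst (_∈ _) h≡ p)
    k≤ : k ≤ suc (m * 2)
    k≤ = s≤s⁻¹ (s≤s⁻¹ (subst (_≤ 3 + m * 2) eq (m∸n≤m (3 + m * 2) h)))
    in-rights : k ∈ g ∷ gs
    in-rights with complete inv k≤ s′
    ... | inj₁ j = contradiction (ListAll.lookup (ListAllPairs.head (descending inv)) j)
                     (≤⇒≯ (≤-trans t≤g g≤k))
    ... | inj₂ j = suffix-∈-≥ (ascending inv) i j g≤k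

-- Every valid ordering arises in the tree.

preimage : ∀ {f : ℕ → ℕ} {v : Vec ℕ n} → All (λ y → ∃ λ x → f x ≡ y) v → ∃ λ w → map f w ≡ v
preimage []             = [] , refl
preimage ((x , p) ∷ ps) with w , q ← preimage ps = x ∷ w , cong₂ _∷_ p q

spread-preimage : {v : Vec ℕ n} → t ≤ g → All (t ≢_) v → All (suc g ≢_) v → ∃ λ w → map (spread t g) w ≡ v
spread-preimage {t = t} {g} t≤g t∉ g∉ = preimage (All.map (λ (p , q) → pre p q) (All.zip (t∉ , g∉)))
  where
  pre : ∀ {y} → t ≢ y → suc g ≢ y → ∃ λ x → spread t g x ≡ y
  pre p q with x , s ← unshift t≤g _ (≢-sym p) (≢-sym q) = x , shift-unique (spread-shift t g x) s

shift-≤⁻ : t ≤ g → g ≤ suc N → Shift t g x y → y ≤ 2 + N → x ≤ N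
shift-≤⁻ t≤g g≤ (low p)    _  = s≤s⁻¹ (<-≤-trans p (≤-trans t≤g g≤))
shift-≤⁻ t≤g g≤ (mid _ p)  _  = s≤s⁻¹ (<-≤-trans p g≤)
shift-≤⁻ t≤g g≤ (high _ _) y≤ = s≤s⁻¹ (s≤s⁻¹ y≤)

valid-uninsert : ∀ {w} → o ≤ g → g ≤ suc (m * 2) → Valid M (suc m) (insert o g w) → Valid V m w
valid-uninsert {o} {g} {m} {w@(_ ∷ _)} o≤g g≤ va = mkValid
  (unique-map⁻ (AllPairs-tail² (unique va)))
  (All.map (λ p → shift-≤⁻ o≤g g≤ (spread-shift o g _) p) (All.map⁻ (All.tail (All.tail (bounded va)))))
  (zigzag-map⁻ (spread-mono o g) V m (proj₂ (proj₂ (zigzag va))))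
  (nonCrossing-map⁻ (spread-mono o g) (nonCrossing-tail² (nonCrossing va)))
  where
  AllPairs-tail² : ∀ {n x y} {v : Vec ℕ n} → Unique (x ∷ y ∷ v) → Unique v
  AllPairs-tail² (_ ∷ _ ∷ u) = u
  unique-map⁻ : ∀ {n} {f : ℕ → ℕ} {v : Vec ℕ n} → Unique (map f v) → Unique v
  unique-map⁻ {v = []} []       = []
  unique-map⁻ {f = f} {_ ∷ _} (p ∷ ps) = All.map (_∘ cong f) (All.map⁻ p) ∷ unique-map⁻ ps

-- The face just below the tip opens an odd arc that covers the tip, so an odd
-- arc from the tip cannot leave past it.
insert-at-tip : ∀ {v : Vec ℕ n} → o ≤ g → LeftSite (t ∷ v) t → Unique (t ∷ v) →
  NonCrossing (insert o g (t ∷ v)) → o < spread o g t → o ≡ t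
insert-at-tip o≤g (_ , inj₁ refl) _ _ o<ft = n≤0⇒n≡0 (t<shift⁻ o≤g (spread-shift _ _ _) o<ft)
insert-at-tip {o = o} {g} {t = t} o≤g (_ , inj₂ (x , y , even a , refl , x<y)) (t∉ ∷ _) nx o<ft
  with m≤n⇒m<n∨m≡n (t<shift⁻ o≤g (spread-shift o g t) o<ft)
... | inj₂ o≡t = o≡t
... | inj₁ (s≤s o≤x) = ⊥-elim (nx (even here) (even (odd (even (arc-map⁺ (spread o g) a))))
        (t<shift⁺ o≤g (spread-shift o g x) o≤x)
        (spread-mono o g (n<1+n x))
        (spread-mono o g (≤∧≢⇒< x<y (arc-All t∉ (arc-sym a)))))

-- Suppose a bottom arc runs from `x < g` to `y ≥ g`. If `t ≤ x`, it leaves the interval between `o`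
-- and `e` and crosses the new bottom arc; if `x < t`, exposure of gap `t` keeps `y` below `t`.
insert-at-site : ∀ {v : Vec ℕ n} → t ≤ g → Site (t ∷ v) t →
  NonCrossing (insert t g (t ∷ v)) → Site (t ∷ v) g
insert-at-site {t = t} {g} t≤g st nx x y a x<g with y <? g | x <? t
... | yes y<g | _       = y<g
... | no  _   | yes x<t = <-≤-trans (st _ _ a x<t) t≤g
... | no  y≮g | no  x≮t = ⊥-elim (nx here˘ (odd (even (arc-map⁺ (spread t g) a)))
        (t<shift⁺ t≤g (spread-shift t g x) (≮⇒≥ x≮t))
        (shift<g+1⁺ t≤g (spread-shift t g x) x<g)
        (subst (suc g <_) (sym (shift-high t≤g (≮⇒≥ y≮g) (spread-shift t g y))) (s≤s (s≤s (≮⇒≥ y≮g)))))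

-- The smaller ordering `w` comes before any state, because the state is found by induction on `w`;
-- only its invariant then pins `o` to the tip and places `g` among the choices.
valid⇒insert : ∀ {m u} → Valid M (suc m) u → ∃ λ w → Valid V m w ×
  (∀ {st : State m} → Invariant st → layers st ≡ w →
     ∃ λ g → g ∈ tip st ∷ rights st × u ≡ insert (tip st) g (layers st))
valid⇒insert {m} {suc g ∷ o ∷ τ@(_ ∷ _)} va
  with s≤s o≤g , o<t , _ ← zigzag va
     | (_ ∷ g∉) ∷ o∉ ∷ _ ← unique va
     | s≤s g≤ ∷ _ ← bounded va
  with w@(t ∷ w′) , refl ← spread-preimage o≤g o∉ g∉
  = w , valid-uninsert o≤g g≤ va , attach
  where
  attach : ∀ {st : State m} → Invariant st → layers st ≡ t ∷ w′ →
    ∃ λ h → h ∈ tip st ∷ rights st × insert o g (t ∷ w′) ≡ insert (tip st) h (layers st)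
  attach {⟨ _ ∷ _ , L , R ⟩} inv refl
    with refl ← insert-at-tip o≤g (ListAll.head (leftSites inv)) (unique (valid inv)) (nonCrossing va) o<t
    with complete inv g≤ (insert-at-site o≤g (proj₁ (ListAll.head (leftSites inv))) (nonCrossing va))
  ... | inj₁ i = contradiction (ListAll.lookup (ListAllPairs.head (descending inv)) i) (≤⇒≯ o≤g)
  ... | inj₂ i = g , i , refl

children : State m → List (State (suc m))
children st = List.map (step st) (choices st)

states : ∀ m → List (State m)
-- One face has two gaps: gap 0 is that of the tip and gap 1 lies to its right, so `p = 1` and
-- `q = 0`.
states zero    = ⟨ 0 ∷ [] , [] , 1 ∷ [] ⟩ ∷ []
states (suc m) = concatMap children (states m)

invariant-initial : Invariant {0} ⟨ 0 ∷ [] , [] , 1 ∷ [] ⟩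
invariant-initial = mkInvariant
  (mkValid ([] ∷ []) (z≤n ∷ []) _ λ { (odd ()) ; (even ()) })
  (((λ { _ _ (odd ()) }) , inj₁ refl) ∷ [])
  (((λ { _ _ (odd ()) }) , inj₁ refl) ∷ [])
  (z≤n ∷ s≤s z≤n ∷ [])
  ([] ∷ [])
  ((s≤s z≤n ∷ []) ∷ [] ∷ [])
  λ { z≤n _ → inj₂ (here refl) ; (s≤s z≤n) _ → inj₂ (there (here refl)) }

states-invariant : ∀ m → ListAll.All Invariant (states m)
states-invariant zero    = invariant-initial ∷ []
states-invariant (suc m) = ListAll.concat⁺ (ListAll.map⁺ (ListAll.map
  (λ inv → ListAll.map⁺ (ListAll.tabulate (invariant-step inv))) (states-invariant m)))

-- The reflection of `v` opens with an `M` block, which is peeled off; reflecting the reinserted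
-- block again gives back `v`.
states-complete : ∀ m {v} → Valid V m v → ∃ λ st → st ∈ states m × layers st ≡ v
states-complete zero    {zero ∷ []}  va = _ , here refl , refl
states-complete zero    {suc _ ∷ []} va with () ∷ [] ← bounded va
states-complete (suc m) {v} va
  with w , vw , attach ← valid⇒insert (valid-mirror V (suc m) va)
  with st , i , refl ← states-complete m vw
  with g , j , eq ← attach (ListAll.lookup (states-invariant m) i) refl
  with gs , k ← ∈⇒suffix j
  = step st (g , gs)
  , ∈-concatMap⁺ children (Any.map (λ { refl → ∈-map⁺ (step st) k }) i)
  , trans (cong (mirror (2 + m * 2)) (sym eq)) (mirror-involutive (bounded va))

-- No ordering arises twice.

map-injective : ∀ {p} {P Q : Set p} {f : P → Q} → (∀ {x y} → f x ≡ f y → x ≡ y) →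
  {v w : Vec P n} → map f v ≡ map f w → v ≡ w
map-injective inj {[]}    {[]}    _  = refl
map-injective inj {_ ∷ _} {_ ∷ _} eq =
  cong₂ _∷_ (inj (Vec.∷-injectiveˡ eq)) (map-injective inj (Vec.∷-injectiveʳ eq))

insert-injective : ∀ {t t′ g g′} {v w : Vec ℕ n} →
  insert t g v ≡ insert t′ g′ w → g ≡ g′ × v ≡ w
insert-injective {t = t} {g = g} eq
  with refl ← cong head eq | refl ← cong (head ∘ tail) eq
  = refl , map-injective (mono⇒injective (spread-mono t g)) (cong (tail ∘ tail) eq)

-- Undo the reflection; the first two entries then reveal `g` and `t`, hence the embedding
-- `spread t g`, which is injective.
step-injective : ∀ {st st′ : State m} {g g′ gs gs′} → Invariant st → Invariant st′ →
  (g , gs) ∈ choices st → (g′ , gs′) ∈ choices st′ →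
  layers (step st (g , gs)) ≡ layers (step st′ (g′ , gs′)) → g ≡ g′ × layers st ≡ layers st′
step-injective inv inv′ i i′ eq =
  insert-injective (mirror-injective (choice-bounded inv i) (choice-bounded inv′ i′) eq)

states-distinct : ∀ m → AllPairs (_≢_ on layers) (states m)
states-distinct zero    = [] ∷ []
states-distinct (suc m) = ListAllPairs.concat⁺
  (ListAll.map⁺ (ListAll.map siblings (states-invariant m)))
  (ListAllPairs.map⁺ (ListAllPairs.map cousins
    (AllPairs-zip-All (states-invariant m) (states-distinct m))))
  where
  siblings : ∀ {st} → Invariant st → AllPairs (_≢_ on layers) (children st)
  siblings inv = ListAllPairs.map⁺ (ListAllPairs.map
    (λ (i , i′ , g<g′) eq → <⇒≢ g<g′ (proj₁ (step-injective inv inv i i′ eq)))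
    (AllPairs-zip-All (ListAll.tabulate id) (suffixes-AllPairs (ascending inv))))
  cousins : ∀ {st st′} → Invariant st × Invariant st′ × layers st ≢ layers st′ →
    ListAll.All (λ x → ListAll.All (λ y → layers x ≢ layers y) (children st′)) (children st)
  cousins (inv , inv′ , ne) = ListAll.map⁺ (ListAll.tabulate λ i →
    ListAll.map⁺ (ListAll.tabulate λ i′ eq → ne (proj₂ (step-injective inv inv′ i i′ eq))))

-- Counting the states.

weight : ℕ → State m → ℕ
weight k st = descendants k (length (rights st)) (length (lefts st))

sum-suffixes : ∀ F (x : A) xs → sum (List.map (F ∘ length ∘ proj₂) (suffixes (x ∷ xs))) ≡ sumTo (length xs) F
sum-suffixes F x []       = +-identityʳ (F 0)
sum-suffixes F x (y ∷ ys) = cong (F (length (y ∷ ys)) +_) (sum-suffixes F y ys)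

weight-children : ∀ k (st : State m) → sum (List.map (weight k) (children st)) ≡ weight (suc k) st
weight-children {m} k st = begin
  sum (List.map (weight k) (children st))              ≡⟨ cong sum (map-∘ (choices st)) ⟨
  sum (List.map (weight k ∘ step st) (choices st))     ≡⟨ cong sum (map-cong weight-step (choices st)) ⟩
  sum (List.map (F ∘ length ∘ proj₂) (choices st))     ≡⟨ sum-suffixes F (tip st) (rights st) ⟩
  weight (suc k) st                                    ∎
  where
  open ≡-Reasoning
  F : ℕ → ℕ
  F = descendants k (suc (length (lefts st)))
  weight-step : ∀ c → weight k (step st c) ≡ F (length (proj₂ c))
  weight-step (g , gs) = cong₂ (descendants k)
    (length-map (3 + m * 2 ∸_) (tip st ∷ lefts st)) (length-map (suc (m * 2) ∸_) gs)

weight-concatMap : ∀ k (sts : List (State m)) →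
  sum (List.map (weight k) (concatMap children sts)) ≡ sum (List.map (weight (suc k)) sts)
weight-concatMap k []         = refl
weight-concatMap k (st ∷ sts) = begin
  sum (List.map (weight k) (children st ++ concatMap children sts))
    ≡⟨ cong sum (map-++ (weight k) (children st) _) ⟩
  sum (List.map (weight k) (children st) ++ List.map (weight k) (concatMap children sts))
    ≡⟨ sum-++ (List.map (weight k) (children st)) _ ⟩
  sum (List.map (weight k) (children st)) + sum (List.map (weight k) (concatMap children sts))
    ≡⟨ cong₂ _+_ (weight-children k st) (weight-concatMap k sts) ⟩
  weight (suc k) st + sum (List.map (weight (suc k)) sts)
    ∎
  where open ≡-Reasoning

-- Each generation hands its total weight on to the next, so `m` can be traded for `k` down to the
-- single initial state.
weight-states : ∀ m k → sum (List.map (weight k) (states m)) ≡ descendants (m + k) 1 0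
weight-states zero    k = +-identityʳ _
weight-states (suc m) k = begin
  sum (List.map (weight k) (states (suc m)))   ≡⟨ weight-concatMap k (states m) ⟩
  sum (List.map (weight (suc k)) (states m))   ≡⟨ weight-states m (suc k) ⟩
  descendants (m + suc k) 1 0                  ≡⟨ cong (λ j → descendants j 1 0) (+-suc m k) ⟩
  descendants (suc m + k) 1 0                  ∎
  where open ≡-Reasoning

sum-ones : (xs : List A) → sum (List.map (λ _ → 1) xs) ≡ length xs
sum-ones []       = refl
sum-ones (_ ∷ xs) = cong suc (sum-ones xs)

length-states : ∀ m → length (states m) ≡ ballot ⌊ m /2⌋ 1 * ballot ⌈ m /2⌉ 1
length-states m = begin
  -- `weight 0` is constantly 1.
  length (states m)                     ≡⟨ sum-ones (states m) ⟨
  sum (List.map (weight 0) (states m))  ≡⟨ weight-states m 0 ⟩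
  descendants (m + 0) 1 0               ≡⟨ cong (λ j → descendants j 1 0) (+-identityʳ m) ⟩
  descendants m 1 0                     ≡⟨ descendants-product m 1 0 ⟩
  ballot ⌊ m /2⌋ 1 * ballot ⌈ m /2⌉ 1   ∎
  where open ≡-Reasoning

-- Layer orderings as vectors of natural numbers

even?-suc : ∀ k → even? (suc k) ≡ not (even? k)
even?-suc zero          = refl
even?-suc (suc zero)    = refl
even?-suc (suc (suc k)) = even?-suc k

arc-∷ : ∀ k → Arc (even? k) v x y → Arc (even? (suc k)) (z ∷ v) x y
arc-∷ zero          a = even a
arc-∷ (suc zero)    a = odd a
arc-∷ (suc (suc k)) a = arc-∷ k a

crease⇒arc : ∀ {k} (σ : Vec (Fin N) (suc k)) c →
  Arc (even? (toℕ c)) (map toℕ σ) (toℕ (lookup σ (inject₁ c))) (toℕ (lookup σ (suc c)))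
crease⇒arc (_ ∷ _ ∷ _)     zero    = here
crease⇒arc (_ ∷ σ@(_ ∷ _)) (suc c) = arc-∷ (toℕ c) (crease⇒arc σ c)

arc⇒crease : ∀ {k} (σ : Vec (Fin N) (suc k)) → Arc b (map toℕ σ) x y →
  ∃ λ c → even? (toℕ c) ≡ b ×
    let l = toℕ (lookup σ (inject₁ c)) ; r = toℕ (lookup σ (suc c)) in
    (x ≡ l × y ≡ r) ⊎ (x ≡ r × y ≡ l)
arc⇒crease (_ ∷ _ ∷ _) here  = zero , refl , inj₁ (refl , refl)
arc⇒crease (_ ∷ _ ∷ _) here˘ = zero , refl , inj₂ (refl , refl)
arc⇒crease (_ ∷ σ@(_ ∷ _)) (odd a) with c , p , q ← arc⇒crease σ a =
  suc c , trans (even?-suc (toℕ c)) (cong not p) , q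
arc⇒crease (_ ∷ σ@(_ ∷ _)) (even a) with c , p , q ← arc⇒crease σ a =
  suc c , trans (even?-suc (toℕ c)) (cong not p) , q
arc⇒crease (_ ∷ []) (odd ())
arc⇒crease (_ ∷ []) (even ())

-- The orientations in which the two arcs traverse their creases select one of the four rotations.
NoCrossing⇒NonCrossing : ∀ {k} (μ : Vec MV k) σ → NoCrossing μ σ → NonCrossing (map toℕ σ)
NoCrossing⇒NonCrossing μ σ nc a a′ p q r
  with c , e , s ← arc⇒crease σ a | d , e′ , s′ ← arc⇒crease σ a′
  with eq ← trans e (sym e′)
  with s | s′
... | inj₁ (refl , refl) | inj₁ (refl , refl) = nc c d eq (inj₁ (p , q , r))
... | inj₁ (refl , refl) | inj₂ (refl , refl) = nc d c (sym eq) (inj₂ (inj₁ (p , q , r)))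
... | inj₂ (refl , refl) | inj₁ (refl , refl) = nc d c (sym eq) (inj₂ (inj₂ (inj₂ (p , q , r))))
... | inj₂ (refl , refl) | inj₂ (refl , refl) = nc c d eq (inj₂ (inj₂ (inj₁ (p , q , r))))

NonCrossing⇒NoCrossing : ∀ {k} (μ : Vec MV k) σ → NonCrossing (map toℕ σ) → NoCrossing μ σ
NonCrossing⇒NoCrossing μ σ nx c d eq = λ where
    (inj₁ (p , q , r))               → nx α α′ p q r
    (inj₂ (inj₁ (p , q , r)))        → nx α′ (arc-sym α) p q r
    (inj₂ (inj₂ (inj₁ (p , q , r)))) → nx (arc-sym α) (arc-sym α′) p q r
    (inj₂ (inj₂ (inj₂ (p , q , r)))) → nx (arc-sym α′) α p q r
  where
  α  = subst (λ b → Arc b (map toℕ σ) _ _) eq (crease⇒arc σ c)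
  α′ = crease⇒arc σ d

Creases : ∀ m → Vec (Fin N) (suc (m * 2)) → Set
Creases m σ = ∀ c → if reversed (lookup (twoAlt m) c) (toℕ c)
                      then toℕ (lookup σ (suc c)) < toℕ (lookup σ (inject₁ c))
                      else toℕ (lookup σ (inject₁ c)) < toℕ (lookup σ (suc c))

-- Stripping two blocks lowers the crease index by four and keeps its parity; the equation reduces
-- only once the label is known.
reversed-periodic : ∀ s k {P Q : Set} →
  (if reversed s (4 + k) then P else Q) ≡ (if reversed s k then P else Q)
reversed-periodic M k = refl
reversed-periodic V k = refl

creases⇒zigzag : ∀ m (σ : Vec (Fin N) (suc (m * 2))) → Creases m σ → Zigzag M m (map toℕ σ)
creases⇒zigzag zero          σ               ok = _
creases⇒zigzag (suc zero)    (_ ∷ _ ∷ _ ∷ _) ok = ok zero , ok (suc zero) , _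
creases⇒zigzag (suc (suc m)) (_ ∷ _ ∷ _ ∷ _ ∷ σ@(_ ∷ _)) ok =
  ok zero , ok (suc zero) , ok (suc (suc zero)) , ok (suc (suc (suc zero))) ,
  creases⇒zigzag m σ λ c → subst id
    (reversed-periodic (lookup (twoAlt m) c) (toℕ c)) (ok (suc (suc (suc (suc c)))))

zigzag⇒creases : ∀ m (σ : Vec (Fin N) (suc (m * 2))) → Zigzag M m (map toℕ σ) → Creases m σ
zigzag⇒creases (suc zero) (_ ∷ _ ∷ _ ∷ _) (p , q , _) zero       = p
zigzag⇒creases (suc zero) (_ ∷ _ ∷ _ ∷ _) (p , q , _) (suc zero) = q
zigzag⇒creases (suc (suc m)) (_ ∷ _ ∷ _ ∷ _ ∷ _ ∷ _) (p , _) zero                                 = p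
zigzag⇒creases (suc (suc m)) (_ ∷ _ ∷ _ ∷ _ ∷ _ ∷ _) (_ , p , _) (suc zero)                       = p
zigzag⇒creases (suc (suc m)) (_ ∷ _ ∷ _ ∷ _ ∷ _ ∷ _) (_ , _ , p , _) (suc (suc zero))             = p
zigzag⇒creases (suc (suc m)) (_ ∷ _ ∷ _ ∷ _ ∷ _ ∷ _) (_ , _ , _ , p , _) (suc (suc (suc zero)))   = p
zigzag⇒creases (suc (suc m)) (_ ∷ _ ∷ _ ∷ _ ∷ σ@(_ ∷ _)) (_ , _ , _ , _ , z) (suc (suc (suc (suc c)))) =
  subst id (sym (reversed-periodic (lookup (twoAlt m) c) (toℕ c)))
    (zigzag⇒creases m σ z c)

ordering⇔valid : ∀ m σ → ValidLayerOrdering (twoAlt m) σ ⇔ Valid M m (map toℕ σ)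
ordering⇔valid m σ = mk⇔
  (λ (perm , crease , nc) → mkValid
    (Unique.map⁺ toℕ-injective (subst Unique (Vec.tabulate∘lookup σ) (Unique.tabulate⁺ (perm _ _))))
    (All.map⁺ (All.universal toℕ≤pred[n] σ))
    (creases⇒zigzag m σ crease)
    (NoCrossing⇒NonCrossing (twoAlt m) σ nc))
  (λ va →
    (λ i j eq → Unique.lookup-injective (unique va) i j (begin
      lookup (map toℕ σ) i  ≡⟨ Vec.lookup-map i toℕ σ ⟩
      toℕ (lookup σ i)      ≡⟨ cong toℕ eq ⟩
      toℕ (lookup σ j)      ≡⟨ Vec.lookup-map j toℕ σ ⟨
      lookup (map toℕ σ) j  ∎)) ,
    zigzag⇒creases m σ (zigzag va) ,
    NonCrossing⇒NoCrossing (twoAlt m) σ (nonCrossing va))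
  where open ≡-Reasoning

-- The states start with a `V` block and the orderings with an `M` block. Merging the reflection
-- with the passage to `Fin` makes the bound hold for every `x`, without a proof about `v`.
mirrorFin : ∀ N → Vec ℕ n → Vec (Fin (suc N)) n
mirrorFin N = map (λ x → fromℕ< (s≤s (m∸n≤m N x)))

toℕ-mirrorFin : ∀ N (v : Vec ℕ n) → map toℕ (mirrorFin N v) ≡ mirror N v
toℕ-mirrorFin N v = trans (sym (Vec.map-∘ _ _ v)) (Vec.map-cong (λ x → toℕ-fromℕ< (s≤s (m∸n≤m N x))) v)

mirrorFin-injective : {v w : Vec ℕ n} → All (_≤ N) v → All (_≤ N) w →
  mirrorFin N v ≡ mirrorFin N w → v ≡ w
mirrorFin-injective {N = N} p q eq = mirror-injective p q
  (trans (sym (toℕ-mirrorFin N _)) (trans (cong (map toℕ) eq) (toℕ-mirrorFin N _)))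

orderings : ∀ m → List (Vec (Fin (suc (m * 2))) (suc (m * 2)))
orderings m = List.map (mirrorFin (m * 2) ∘ layers) (states m)

orderings-distinct : ∀ m → AllPairs _≢_ (orderings m)
orderings-distinct m = ListAllPairs.map⁺ (ListAllPairs.map
  (λ (inv , inv′ , ne) → ne ∘ mirrorFin-injective (bounded (valid inv)) (bounded (valid inv′)))
  (AllPairs-zip-All (states-invariant m) (states-distinct m)))

∈-orderings : ∀ m σ → σ ∈ orderings m ⇔ Valid M m (map toℕ σ)
∈-orderings m σ = mk⇔ to from
  where
  to : σ ∈ orderings m → Valid M m (map toℕ σ)
  to i with st , j , refl ← ∈-map⁻ (mirrorFin (m * 2) ∘ layers) i =
    subst (Valid M m) (sym (toℕ-mirrorFin (m * 2) (layers st)))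
      (valid-mirror V m (valid (ListAll.lookup (states-invariant m) j)))
  from : Valid M m (map toℕ σ) → σ ∈ orderings m
  from va with st , j , eq ← states-complete m (valid-mirror M m va) =
    subst (_∈ orderings m) (map-injective toℕ-injective (begin
      map toℕ (mirrorFin (m * 2) (layers st))  ≡⟨ toℕ-mirrorFin (m * 2) (layers st) ⟩
      mirror (m * 2) (layers st)               ≡⟨ cong (mirror (m * 2)) eq ⟩
      mirror (m * 2) (mirror (m * 2) (map toℕ σ))    ≡⟨ mirror-involutive (bounded va) ⟩
      map toℕ σ                          ∎))
    (∈-map⁺ (mirrorFin (m * 2) ∘ layers) j)
    where open ≡-Reasoning

length-orderings : ∀ m → length (orderings m) ≡ catalan (⌊ m /2⌋ + 1) * catalan (⌈ m /2⌉ + 1)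
length-orderings m = begin
  length (orderings m)                              ≡⟨ length-map _ (states m) ⟩
  length (states m)                                 ≡⟨ length-states m ⟩
  ballot ⌊ m /2⌋ 1 * ballot ⌈ m /2⌉ 1               ≡⟨ cong₂ _*_ (ballot≡catalan ⌊ m /2⌋) (ballot≡catalan ⌈ m /2⌉) ⟩
  catalan (⌊ m /2⌋ + 1) * catalan (⌈ m /2⌉ + 1)     ∎
  where open ≡-Reasoning

theorem3p3 : (m : ℕ) → 1 ≤ m →
    HasCount (ValidLayerOrdering (twoAlt m))
    (catalan (⌊ m /2⌋ + 1) * catalan (⌈ m /2⌉ + 1))
theorem3p3 m _ =
  orderings m , orderings-distinct m , length-orderings m , λ σ →
    ⇔-sym (ordering⇔valid m σ) ⇔-∘ ∈-orderings m σ
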